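{- Let $\alpha\ge 4$ and $k=2$. Then the probability that the uniform random temporal star $G_s(\alpha,2)$ on $n$ vertices is explorable (all its edges can be explored) tends to $0$ as $n\to\infty$.
   Context: A uniform random temporal star $G_s(\alpha,k)$: take a star $G_s$ with center $c$ and $n-1$ leaves; each edge independently receives $k$ labels, each chosen independently and uniformly at random from $\{1,2,\dots,\alpha\}$ (labels are the discrete times at which the edge is available). A journey is a sequence of time edges $(u,u_1,l_1),(u_1,u_2,l_2),\dots$, each $l_t$ a label of the edge traversed, with strictly increasing labels. The temporal star is explorable if there is a journey starting and ending at $c$ that visits every vertex. -}

module Defs where

open import Data.Nat as ℕ using (ℕ; zero; suc; _+_; _*_; _^_; _≤_; _<_; _≥_; z≤n; s≤s; NonZero)
import Data.Nat.Properties as ℕₚ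
open import Data.Integer using (+_)
open import Data.Rational as ℚ using (ℚ; 0ℚ)
open import Data.Fin as Fin using (Fin; toℕ)
import Data.Fin.Properties as Finₚ
open import Data.List as List using (List; []; _∷_; length; filter; cartesianProductWith; allFin)
import Data.List.Properties as Listₚ
import Data.List.Membership.Propositional as ListMem
import Data.List.Relation.Unary.Any as Any
open import Data.Vec as Vec using (Vec; []; _∷_; lookup)
open import Data.Vec.Membership.Propositional using (_∈_)
import Data.Vec.Membership.DecPropositional as DecVecMem
open import Data.Product using (Σ-syntax; ∃-syntax; _×_; _,_)
open import Function using (_∘_)
open import Relation.Nullary using (Dec; yes; no; contradiction)
open import Relation.Nullary.Decidable as Dec using (_×-dec_)
open import Relation.Unary using (Pred; Decidable)
open import Relation.Binary.PropositionalEquality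
  using (_≡_; refl; sym; trans; cong; cong₂; subst)
open import Level using (0ℓ)

-- Temporal stars with m leaves; the edges are identified with the leaves.

data Vertex (m : ℕ) : Set where
  c    : Vertex m
  leaf : Fin m → Vertex m

data _—[_]→_ {m : ℕ} : Vertex m → Fin m → Vertex m → Set where
  out  : ∀ {e} → c —[ e ]→ leaf e
  back : ∀ {e} → leaf e —[ e ]→ c

-- Each edge carries k labels, possibly with repetitions.
Labelling : (m α k : ℕ) → Set
Labelling m α k = Vec (Vec (Fin α) k) m

-- The elements of Fin α stand for the times 1, …, α.
time : ∀ {α} → Fin α → ℕ
time l = suc (toℕ l)

module _ {m α k : ℕ} (L : Labelling m α k) where

  -- JourneyAfter t u v: journeys from u to v all of whose labels exceed t.
  data JourneyAfter (t : ℕ) : Vertex m → Vertex m → Set where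
    stop : ∀ {u} → JourneyAfter t u u
    step : ∀ {u w v} (e : Fin m) (l : Fin α) →
           u —[ e ]→ w → l ∈ lookup L e → t < time l →
           JourneyAfter (time l) w v → JourneyAfter t u v

  -- Every time is at least 1, so the bound 0 is no constraint.
  Journey : Vertex m → Vertex m → Set
  Journey = JourneyAfter 0

  visited : ∀ {t u v} → JourneyAfter t u v → List (Vertex m)
  visited {u = u} stop                 = u ∷ []
  visited {u = u} (step _ _ _ _ _ j) = u ∷ visited j

  Explorable : Set
  Explorable = Σ[ j ∈ Journey c c ] (∀ v → v ListMem.∈ visited j)

-- Decidability of explorability, needed only so that explorable labellings
-- can be counted. The fuel f bounds the number of times left after t.

module _ {m : ℕ} where

  _≟ᵛ_ : (u v : Vertex m) → Dec (u ≡ v)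
  c      ≟ᵛ c      = yes refl
  c      ≟ᵛ leaf _ = no λ ()
  leaf _ ≟ᵛ c      = no λ ()
  leaf i ≟ᵛ leaf j = Dec.map′ (cong leaf) (λ { refl → refl }) (i Finₚ.≟ j)

  allVertices? : {P : Pred (Vertex m) 0ℓ} → Decidable P → Dec (∀ v → P v)
  allVertices? P? = Dec.map′
    (λ { (p , q) c → p ; (p , q) (leaf i) → q i })
    (λ f → f c , f ∘ leaf)
    (P? c ×-dec Finₚ.all? (P? ∘ leaf))

  anyStep? : (u : Vertex m) {P : Fin m → Vertex m → Set} →
             (∀ e w → Dec (P e w)) → Dec (∃[ e ] ∃[ w ] u —[ e ]→ w × P e w)
  anyStep? c P? = Dec.map′
    (λ { (e , p) → e , leaf e , out , p })
    (λ { (e , _ , out , p) → e , p })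
    (Finₚ.any? λ e → P? e (leaf e))
  anyStep? (leaf e) P? = Dec.map′
    (λ p → e , c , back , p)
    (λ { (_ , _ , back , p) → p })
    (P? e c)

module _ {m α k : ℕ} (L : Labelling m α k) where

  open DecVecMem (Finₚ._≟_ {α}) using () renaming (_∈?_ to _∈ᵛ?_)

  journey? : ∀ f t → α ≤ f + t → (u v : Vertex m)
             {Q : Pred (List (Vertex m)) 0ℓ} → Decidable Q →
             Dec (Σ[ j ∈ JourneyAfter L t u v ] Q (visited L j))
  journey? f t α≤f+t u v {Q} Q? with u ≟ᵛ v ×-dec Q? (u ∷ [])
  ... | yes (refl , q) = yes (stop , q)
  ... | no ¬stop = continue f α≤f+t
    where
    continue : ∀ f → α ≤ f + t → Dec (Σ[ j ∈ JourneyAfter L t u v ] Q (visited L j))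
    continue zero α≤t = no λ
      { (stop , q) → ¬stop (refl , q)
      ; (step e l _ _ t<l _ , _) →
          ℕₚ.<⇒≱ t<l (ℕₚ.≤-trans (Finₚ.toℕ<n l) α≤t) }
    continue (suc f) α≤f+t = Dec.map′
      (λ { (e , w , s , l , l∈ , t<l , j , q) → step e l s l∈ t<l j , q })
      (λ { (stop , q) → contradiction (refl , q) ¬stop
         ; (step e l s l∈ t<l j , q) → e , _ , s , l , l∈ , t<l , j , q })
      (anyStep? u λ e w → Finₚ.any? λ l → (l ∈ᵛ? lookup L e) ×-dec later? w l)
      where
      later? : ∀ w l → Dec (t < time l ×
        Σ[ j ∈ JourneyAfter L (time l) w v ] Q (u ∷ visited L j))
      later? w l with t ℕₚ.<? time l
      ... | no  t≮l = no λ { (t<l , _) → t≮l t<l }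
      ... | yes t<l = Dec.map′ (t<l ,_) (λ { (_ , j) → j })
        (journey? f (time l) α≤f+l w v {Q ∘ (u ∷_)} (Q? ∘ (u ∷_)))
        where
        α≤f+l : α ≤ f + time l
        α≤f+l = ℕₚ.≤-trans α≤f+t
          (ℕₚ.≤-trans (ℕₚ.≤-reflexive (sym (ℕₚ.+-suc f t))) (ℕₚ.+-monoʳ-≤ f t<l))

explorable? : ∀ {m α k} → Decidable (Explorable {m} {α} {k})
explorable? {α = α} L = journey? L α 0 (ℕₚ.m≤m+n α 0) c c
  (λ vs → allVertices? (λ v → Any.any? (v ≟ᵛ_) vs))

-- Uniform probability on a finite sample space listed without repetitions.

uniformPr : {A : Set} (Ω : List A) .{{_ : NonZero (length Ω)}}
            {P : Pred A 0ℓ} → Decidable P → ℚ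
uniformPr Ω P? = + length (filter P? Ω) ℚ./ length Ω

allVecs : {A : Set} → List A → (n : ℕ) → List (Vec A n)
allVecs xs zero    = [] ∷ []
allVecs xs (suc n) = cartesianProductWith _∷_ xs (allVecs xs n)

-- The uniform distribution on this product space is the law of m * k
-- independent uniform labels.
allLabellings : (m α k : ℕ) → List (Labelling m α k)
allLabellings m α k = allVecs (allVecs (allFin α) k) m

length-cartesianProductWith : {A B C : Set} (f : A → B → C) (xs : List A) (ys : List B) →
  length (cartesianProductWith f xs ys) ≡ length xs * length ys
length-cartesianProductWith f []       ys = refl
length-cartesianProductWith f (x ∷ xs) ys =
  trans (Listₚ.length-++ (List.map (f x) ys))
        (cong₂ _+_ (Listₚ.length-map (f x) ys) (length-cartesianProductWith f xs ys))

length-allVecs : {A : Set} (xs : List A) (n : ℕ) → length (allVecs xs n) ≡ length xs ^ n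
length-allVecs xs zero    = refl
length-allVecs xs (suc n) =
  trans (length-cartesianProductWith _∷_ xs (allVecs xs n))
        (cong (length xs *_) (length-allVecs xs n))

length-allLabellings : ∀ m α k → length (allLabellings m α k) ≡ (α ^ k) ^ m
length-allLabellings m α k =
  trans (length-allVecs (allVecs (allFin α) k) m)
        (cong (_^ m) (trans (length-allVecs (allFin α) k)
                            (cong (_^ k) (Listₚ.length-tabulate {n = α} (λ i → i)))))

allLabellings-nonZero : ∀ m α k → .{{NonZero α}} → NonZero (length (allLabellings m α k))
allLabellings-nonZero m α k =
  subst NonZero (sym (length-allLabellings m α k))
        (ℕₚ.m^n≢0 (α ^ k) m {{ℕₚ.m^n≢0 α k}})

-- The star on n ≥ 1 vertices has n ∸ 1 leaves (n = 0 is a junk value).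
explorationProbability : (n α k : ℕ) .{{_ : NonZero α}} → ℚ
explorationProbability n α k =
  uniformPr (allLabellings (n ℕ.∸ 1) α k) {{allLabellings-nonZero (n ℕ.∸ 1) α k}}
            (explorable? {n ℕ.∸ 1} {α} {k})

4≤⇒nonZero : ∀ {n} → 4 ≤ n → NonZero n
4≤⇒nonZero 4≤n = ℕ.>-nonZero (ℕₚ.≤-trans (s≤s z≤n) 4≤n)

-- For rational sequences and limits, rational ε give the usual real convergence.
_TendsTo_ : (ℕ → ℚ) → ℚ → Set
s TendsTo x = ∀ (ε : ℚ) → 0ℚ ℚ.< ε →
  ∃[ N ] (∀ n → n ≥ N → ℚ.∣ s n ℚ.- x ∣ ℚ.< ε)

{-# OPTIONS --safe #-}
-- A journey explores a leaf by going out at one label of its edge and coming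
-- back at a larger one. With two labels per edge this uses both of them, so the
-- label intervals of distinct edges are disjoint. If the intervals
-- spanned by {a , b} and {a′ , b′} are disjoint, then those spanned by {a , a′} and
-- {b , b′} are not; as exchanging b and a′ preserves the uniform measure, two
-- independent edges have disjoint intervals with probability at most 1/2. Cutting the m edges into
-- ⌊ m /2⌋ independent pairs bounds the probability of explorability by
-- 1 / 2 ^ ⌊ m /2⌋, uniformly in α.
module Submission where

open import Defs
open import Data.Nat using (ℕ; zero; suc; _+_; _*_; _^_; _∸_; _≤_; _<_; z≤n; s≤s; s≤s⁻¹; ⌊_/2⌋; NonZero)
open import Data.Nat.Properties
open import Data.Nat.ListAction using (sum)
open import Data.Nat.ListAction.Properties using (sum-++)
open import Data.Nat.Tactic.RingSolver using (solve-∀)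
open import Data.Integer as ℤ using (+<+)
import Data.Integer.Properties as ℤₚ
open import Data.Rational as ℚ using (ℚ; mkℚ; 0ℚ; toℚᵘ)
import Data.Rational.Properties as ℚₚ
import Data.Rational.Unnormalised as ℚᵘ
import Data.Rational.Unnormalised.Properties as ℚᵘₚ
open import Data.Fin as Fin using (Fin)
import Data.Fin.Properties as Finₚ
open import Data.List using (List; []; _∷_; length; map; filter; cartesianProductWith; allFin; _++_)
open import Data.List.Properties using (map-++; map-cong; map-∘)
import Data.List.Membership.Propositional as ListMem
open import Data.List.Relation.Unary.Any using (here; there)
open import Data.Vec using (Vec; []; _∷_; lookup)
open import Data.Vec.Membership.Propositional using (_∈_)
import Data.Vec.Relation.Unary.Any as VecAny
open import Data.Vec.Relation.Unary.All as All using (All; []; _∷_)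
open import Data.Product using (_,_)
open import Data.Sum using (_⊎_; inj₁; inj₂)
open import Data.Empty using (⊥)
open import Function using (_∘_)
open import Level using (0ℓ)
open import Relation.Nullary using (Dec; yes; no; contradiction)
open import Relation.Nullary.Decidable using (_⊎-dec_)
open import Relation.Unary using (Pred; Decidable)
open import Relation.Binary.PropositionalEquality

-- Disjoint label intervals.

Before : ∀ {α k l} → Vec (Fin α) k → Vec (Fin α) l → Set
Before v w = All (λ a → All (a Fin.<_) w) v

-- Encodes disjointness of the spanned intervals without minima or maxima, so the order of the
-- entries inside a vector is immaterial.
Separated : ∀ {α k l} → Vec (Fin α) k → Vec (Fin α) l → Set
Separated v w = Before v w ⊎ Before w v

separated? : ∀ {α k l} (v : Vec (Fin α) k) (w : Vec (Fin α) l) → Dec (Separated v w)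
separated? v w = before? v w ⊎-dec before? w v
  where
  before? : ∀ {k l} (v : Vec _ k) (w : Vec _ l) → Dec (Before v w)
  before? v w = All.all? (λ a → All.all? (a Finₚ.<?_) w) v

-- The first separation orders `a`, `b′` the same way as `b`, `a′`; the second orders `a`, `b′` the
-- opposite way to `b`, `a′`.
separated-exchange : ∀ {α} (a b a′ b′ : Fin α) → Separated (a ∷ b ∷ []) (a′ ∷ b′ ∷ []) →
                     Separated (a ∷ a′ ∷ []) (b ∷ b′ ∷ []) → ⊥
separated-exchange a b a′ b′ (inj₁ (_ ∷ (b<a′ ∷ _) ∷ [])) (inj₁ (_ ∷ (a′<b ∷ _) ∷ [])) = <-asym b<a′ a′<b
separated-exchange a b a′ b′ (inj₁ ((_ ∷ a<b′ ∷ []) ∷ _)) (inj₂ (_ ∷ (b′<a ∷ _) ∷ [])) = <-asym a<b′ b′<a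
separated-exchange a b a′ b′ (inj₂ (_ ∷ (b′<a ∷ _) ∷ [])) (inj₁ ((_ ∷ a<b′ ∷ []) ∷ _)) = <-asym a<b′ b′<a
separated-exchange a b a′ b′ (inj₂ ((_ ∷ a′<b ∷ []) ∷ _)) (inj₂ ((_ ∷ b<a′ ∷ []) ∷ _)) = <-asym b<a′ a′<b

-- Labels used by closed journeys.

-- The journey argument uses `k = 2` here: two distinct members of a two-entry vector exhaust it.
All-two : {A : Set} {P : A → Set} {x y : A} (v : Vec A 2) → x ≢ y →
          x ∈ v → y ∈ v → P x → P y → All P v
All-two (_ ∷ _ ∷ []) x≢y (VecAny.here refl) (VecAny.here refl) _ _ = contradiction refl x≢y
All-two (_ ∷ _ ∷ []) _ (VecAny.here refl) (VecAny.there (VecAny.here refl)) p q = p ∷ q ∷ []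
All-two (_ ∷ _ ∷ []) _ (VecAny.there (VecAny.here refl)) (VecAny.here refl) p q = q ∷ p ∷ []
All-two (_ ∷ _ ∷ []) x≢y (VecAny.there (VecAny.here refl)) (VecAny.there (VecAny.here refl)) _ _ =
  contradiction refl x≢y

time<⇒≢ : ∀ {α} {l l′ : Fin α} → time l < time l′ → l ≢ l′
time<⇒≢ l<l refl = <-irrefl refl l<l

module _ {m α : ℕ} (L : Labelling m α 2) where

  -- A closed journey at `c` splits into excursions out and back along one edge. An excursion uses
  -- two distinct labels, hence all labels of its edge, and labels only grow along the journey.
  visited-labels-later : ∀ {t} (j : JourneyAfter L t c c) {i} → leaf i ListMem.∈ visited L j →
                         All (λ a → t < time a) (lookup L i)
  visited-labels-later stop (here ())
  visited-labels-later stop (there ())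
  -- From `leaf e` the only move is `back` along `e`, so matching two steps at once consumes a whole
  -- excursion.
  visited-labels-later (step e l out l∈ t<l (step e l′ back l′∈ l<l′ j)) (there (here refl)) =
    All-two (lookup L e) (time<⇒≢ l<l′) l∈ l′∈ t<l (<-trans t<l l<l′)
  visited-labels-later (step e l out l∈ t<l (step e l′ back l′∈ l<l′ j)) (there (there i∈)) =
    All.map (<-trans (<-trans t<l l<l′)) (visited-labels-later j i∈)

  -- Induction on excursions: if one of the two leaves is that of the first excursion, its labels
  -- are at most `l′`, while those of the other, visited later, all exceed `l′`.
  visited-separated : ∀ {t} (j : JourneyAfter L t c c) {i i′} → i ≢ i′ →
                      leaf i ListMem.∈ visited L j → leaf i′ ListMem.∈ visited L j →
                      Separated (lookup L i) (lookup L i′)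
  visited-separated stop _ (here ()) _
  visited-separated stop _ (there ()) _
  visited-separated (step e l out l∈ t<l (step e l′ back l′∈ l<l′ j)) = go
    where
    first-before : ∀ {i} → leaf i ListMem.∈ visited L j → Before (lookup L e) (lookup L i)
    first-before i∈ = All-two (lookup L e) (time<⇒≢ l<l′) l∈ l′∈
      -- `time` is `toℕ` shifted by one; `s≤s⁻¹` removes the shift.
      (All.map (λ l′<a → s≤s⁻¹ (<-trans l<l′ l′<a)) (visited-labels-later j i∈))
      (All.map s≤s⁻¹ (visited-labels-later j i∈))

    go : ∀ {i i′} → i ≢ i′ →
         leaf i ListMem.∈ (c ∷ leaf e ∷ visited L j) → leaf i′ ListMem.∈ (c ∷ leaf e ∷ visited L j) →
         Separated (lookup L i) (lookup L i′)
    go i≢i′ (there (here refl)) (there (here refl)) = contradiction refl i≢i′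
    go _    (there (here refl)) (there (there i′∈)) = inj₁ (first-before i′∈)
    go _    (there (there i∈))  (there (here refl)) = inj₂ (first-before i∈)
    go i≢i′ (there (there i∈))  (there (there i′∈)) = visited-separated j i≢i′ i∈ i′∈

PairwiseSeparated : ∀ {m α k} → Labelling m α k → Set
PairwiseSeparated L = ∀ {i j} → i ≢ j → Separated (lookup L i) (lookup L j)

explorable⇒separated : ∀ {m α} (L : Labelling m α 2) → Explorable L → PairwiseSeparated L
explorable⇒separated L (j , all) {i} {i′} i≢i′ = visited-separated L j i≢i′ (all (leaf i)) (all (leaf i′))

-- Finite sums over lists.

∑ : {A : Set} → List A → (A → ℕ) → ℕ
∑ xs f = sum (map f xs)

∑-cong : {A : Set} (xs : List A) {f g : A → ℕ} → (∀ x → f x ≡ g x) → ∑ xs f ≡ ∑ xs g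
∑-cong xs f≗g = cong sum (map-cong f≗g xs)

∑-+ : {A : Set} (xs : List A) (f g : A → ℕ) → ∑ xs (λ x → f x + g x) ≡ ∑ xs f + ∑ xs g
∑-+ []       f g = refl
∑-+ (x ∷ xs) f g rewrite ∑-+ xs f g = interchange (f x) (g x) (∑ xs f) (∑ xs g)
  where
  interchange : ∀ a b c d → a + b + (c + d) ≡ a + c + (b + d)
  interchange = solve-∀

∑-*ˡ : {A : Set} (xs : List A) (k : ℕ) (f : A → ℕ) → ∑ xs (λ x → k * f x) ≡ k * ∑ xs f
∑-*ˡ []       k f = sym (*-zeroʳ k)
∑-*ˡ (x ∷ xs) k f rewrite ∑-*ˡ xs k f = sym (*-distribˡ-+ k (f x) (∑ xs f))

∑-*ʳ : {A : Set} (xs : List A) (f : A → ℕ) (k : ℕ) → ∑ xs (λ x → f x * k) ≡ ∑ xs f * k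
∑-*ʳ xs f k = trans (∑-cong xs (λ x → *-comm (f x) k)) (trans (∑-*ˡ xs k f) (*-comm k (∑ xs f)))

∑-≤ : {A : Set} (xs : List A) {f : A → ℕ} {k : ℕ} → (∀ x → f x ≤ k) → ∑ xs f ≤ length xs * k
∑-≤ []       f≤k = z≤n
∑-≤ (x ∷ xs) f≤k = +-mono-≤ (f≤k x) (∑-≤ xs f≤k)

∑-comm : {A B : Set} (xs : List A) (ys : List B) (f : A → B → ℕ) →
         ∑ xs (λ x → ∑ ys (f x)) ≡ ∑ ys (λ y → ∑ xs (λ x → f x y))
-- A sum of zeros vanishes, being the multiple by 0 of a sum.
∑-comm []       ys f = sym (∑-*ˡ ys 0 (λ _ → 0))
∑-comm (x ∷ xs) ys f rewrite ∑-comm xs ys f = sym (∑-+ ys (f x) _)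

∑-cartesianProductWith : {A B C : Set} (h : A → B → C) (xs : List A) (ys : List B) (f : C → ℕ) →
                         ∑ (cartesianProductWith h xs ys) f ≡ ∑ xs (λ x → ∑ ys (f ∘ h x))
∑-cartesianProductWith h []       ys f = refl
∑-cartesianProductWith h (x ∷ xs) ys f = begin
  sum (map f (map (h x) ys ++ rest))          ≡⟨ cong sum (map-++ f (map (h x) ys) rest) ⟩
  sum (map f (map (h x) ys) ++ map f rest)    ≡⟨ sum-++ (map f (map (h x) ys)) (map f rest) ⟩
  sum (map f (map (h x) ys)) + ∑ rest f       ≡⟨ cong (λ zs → sum zs + ∑ rest f) (map-∘ ys) ⟨
  ∑ ys (f ∘ h x) + ∑ rest f                   ≡⟨ cong (∑ ys (f ∘ h x) +_) (∑-cartesianProductWith h xs ys f) ⟩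
  ∑ ys (f ∘ h x) + ∑ xs (λ x → ∑ ys (f ∘ h x)) ∎
  where
  open ≡-Reasoning
  rest = cartesianProductWith h xs ys

∑-allVecs-suc : {A : Set} (xs : List A) (n : ℕ) (f : Vec A (suc n) → ℕ) →
                ∑ (allVecs xs (suc n)) f ≡ ∑ xs (λ x → ∑ (allVecs xs n) (f ∘ (x ∷_)))
∑-allVecs-suc xs n f = ∑-cartesianProductWith _∷_ xs (allVecs xs n) f

∑-allVecs-2 : {A : Set} (xs : List A) (f : Vec A 2 → ℕ) →
              ∑ (allVecs xs 2) f ≡ ∑ xs (λ x → ∑ xs (λ y → f (x ∷ y ∷ [])))
∑-allVecs-2 xs f = trans (∑-allVecs-suc xs 1 f) (∑-cong xs λ x →
  trans (∑-allVecs-suc xs 0 (f ∘ (x ∷_))) (∑-cong xs λ y → +-identityʳ _))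

-- Counting with weights and indicators.

-- Since `f` need only dominate the indicator of `P`, explorable labellings can be counted by
-- summing a weight that factorises.
length-filter-≤-∑ : {A : Set} {P : Pred A 0ℓ} (P? : Decidable P) (f : A → ℕ) →
                    (∀ x → P x → 1 ≤ f x) → ∀ xs → length (filter P? xs) ≤ ∑ xs f
length-filter-≤-∑ P? f P⇒1≤f []       = z≤n
length-filter-≤-∑ P? f P⇒1≤f (x ∷ xs) with P? x
... | yes Px = +-mono-≤ (P⇒1≤f x Px) (length-filter-≤-∑ P? f P⇒1≤f xs)
... | no  _  = ≤-trans (length-filter-≤-∑ P? f P⇒1≤f xs) (m≤n+m _ (f x))

indicator : {P : Set} → Dec P → ℕ
indicator (yes _) = 1
indicator (no  _) = 0

indicator-true : {P : Set} (P? : Dec P) → P → 1 ≤ indicator P?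
indicator-true (yes _) _ = ≤-refl
indicator-true (no ¬P) P = contradiction P ¬P

indicator-disjoint : {P Q : Set} (P? : Dec P) (Q? : Dec Q) → (P → Q → ⊥) →
                     indicator P? + indicator Q? ≤ 1
indicator-disjoint (yes P) (yes Q) P⇒¬Q = contradiction Q (P⇒¬Q P)
indicator-disjoint (yes _) (no _)  _    = ≤-refl
indicator-disjoint (no _)  (yes _) _    = ≤-refl
indicator-disjoint (no _)  (no _)  _    = z≤n

-- Independent pairs of edges and the exponential bound.

module _ {α : ℕ} where

  private
    F = allFin α
    E = allVecs F 2

  sep : Vec (Fin α) 2 → Vec (Fin α) 2 → ℕ
  sep x y = indicator (separated? x y)

  sepCount : ℕ
  sepCount = ∑ E (λ x → ∑ E (sep x))

  -- `sepCount` over `length E * length E` is the probability that two independent edges have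
  -- disjoint intervals. Adding to the sum its copy with `b` and `a′` exchanged gives summands of at
  -- most 1, by `separated-exchange`.
  2*sepCount≤ : 2 * sepCount ≤ length E * length E
  2*sepCount≤ = begin
    2 * sepCount
      ≡⟨ cong (2 *_) sepCount≡ ⟩
    2 * ∑ F (λ a → T a)
      ≡⟨ ∑-*ˡ F 2 T ⟨
    ∑ F (λ a → 2 * T a)
      ≤⟨ ∑-≤ F 2T≤ ⟩
    -- One factor `length F` for each of the four labels; the final 1 bounds the sum of the two
    -- indicators.
    length F * (length F * (length F * (length F * 1)))
      ≡⟨ assoc (length F) ⟩
    length F ^ 2 * length F ^ 2
      ≡⟨ cong₂ _*_ (length-allVecs F 2) (length-allVecs F 2) ⟨
    length E * length E ∎
    where
    open ≤-Reasoning
    K : Fin α → Fin α → Fin α → Fin α → ℕ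
    K a b a′ b′ = sep (a ∷ b ∷ []) (a′ ∷ b′ ∷ [])

    -- The exchange does not move `a`, so it can stay fixed.
    T T′ : Fin α → ℕ
    T  a = ∑ F λ b → ∑ F λ a′ → ∑ F λ b′ → K a b a′ b′
    T′ a = ∑ F λ b → ∑ F λ a′ → ∑ F λ b′ → K a a′ b b′

    sepCount≡ : sepCount ≡ ∑ F T
    sepCount≡ = trans (∑-allVecs-2 F _) (∑-cong F λ a → ∑-cong F λ b → ∑-allVecs-2 F _)

    2T≡ : ∀ a → 2 * T a ≡ ∑ F λ b → ∑ F λ a′ → ∑ F λ b′ → K a b a′ b′ + K a a′ b b′
    2T≡ a = begin-equality
      2 * T a      ≡⟨ cong (T a +_) (+-identityʳ (T a)) ⟩
      -- Swapping the sums over `b` and `a′` and renaming the variables turns the second `T a` into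
      -- `T′ a`.
      T a + T a    ≡⟨ cong (T a +_) (∑-comm F F λ b a′ → ∑ F λ b′ → K a b a′ b′) ⟩
      T a + T′ a   ≡⟨ ∑-+ F _ _ ⟨
      ∑ F (λ b → (∑ F λ a′ → ∑ F λ b′ → K a b a′ b′) + (∑ F λ a′ → ∑ F λ b′ → K a a′ b b′))
        ≡⟨ ∑-cong F (λ b → trans (∑-cong F λ a′ → ∑-+ F _ _) (∑-+ F _ _)) ⟨
      (∑ F λ b → ∑ F λ a′ → ∑ F λ b′ → K a b a′ b′ + K a a′ b b′) ∎

    2T≤ : ∀ a → 2 * T a ≤ length F * (length F * (length F * 1))
    2T≤ a = begin
      2 * T a ≡⟨ 2T≡ a ⟩
      ∑ F (λ b → ∑ F λ a′ → ∑ F λ b′ → K a b a′ b′ + K a a′ b b′)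
              ≤⟨ ∑-≤ F (λ b → ∑-≤ F λ a′ → ∑-≤ F λ b′ → indicator-disjoint
                   (separated? (a ∷ b ∷ []) (a′ ∷ b′ ∷ []))
                   (separated? (a ∷ a′ ∷ []) (b ∷ b′ ∷ []))
                   (separated-exchange a b a′ b′)) ⟩
      length F * (length F * (length F * 1)) ∎

    assoc : ∀ n → n * (n * (n * (n * 1))) ≡ (n * (n * 1)) * (n * (n * 1))
    assoc = solve-∀

  -- Only the first edge with the second, the third with the fourth, and so on, are compared: these
  -- pairs share no edge, so the sum over all labellings factorises. An unpaired last edge counts as
  -- 1.
  pairWeight : ∀ {m} → Labelling m α 2 → ℕ
  pairWeight []          = 1
  pairWeight (_ ∷ [])    = 1
  pairWeight (x ∷ y ∷ L) = sep x y * pairWeight L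

  separated⇒1≤pairWeight : ∀ {m} (L : Labelling m α 2) → PairwiseSeparated L → 1 ≤ pairWeight L
  separated⇒1≤pairWeight []          _ = ≤-refl
  separated⇒1≤pairWeight (_ ∷ [])    _ = ≤-refl
  separated⇒1≤pairWeight (x ∷ y ∷ L) s = *-mono-≤
    (indicator-true (separated? x y) (s {Fin.zero} {Fin.suc Fin.zero} λ ()))
    (separated⇒1≤pairWeight L λ i≢j →
      s (i≢j ∘ Finₚ.suc-injective ∘ Finₚ.suc-injective))

  -- Independence in counting form: the first two edges and the remaining ones range over a full
  -- product, and the weight is a product along it.
  ∑-pairWeight-suc² : ∀ m → ∑ (allLabellings (2 + m) α 2) pairWeight ≡
                            sepCount * ∑ (allLabellings m α 2) pairWeight
  ∑-pairWeight-suc² m = begin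
    ∑ (allLabellings (2 + m) α 2) pairWeight
      ≡⟨ ∑-allVecs-suc E (suc m) pairWeight ⟩
    ∑ E (λ x → ∑ (allLabellings (1 + m) α 2) (pairWeight ∘ (x ∷_)))
      ≡⟨ ∑-cong E (λ x → ∑-allVecs-suc E m (pairWeight ∘ (x ∷_))) ⟩
    ∑ E (λ x → ∑ E λ y → ∑ (allLabellings m α 2) λ L → sep x y * pairWeight L)
      ≡⟨ ∑-cong E (λ x → ∑-cong E λ y → ∑-*ˡ (allLabellings m α 2) (sep x y) pairWeight) ⟩
    ∑ E (λ x → ∑ E λ y → sep x y * W)
      ≡⟨ ∑-cong E (λ x → ∑-*ʳ E (sep x) W) ⟩
    ∑ E (λ x → ∑ E (sep x) * W)
      ≡⟨ ∑-*ʳ E (λ x → ∑ E (sep x)) W ⟩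
    sepCount * W ∎
    where
    open ≡-Reasoning
    W = ∑ (allLabellings m α 2) pairWeight

  -- Each pair gains a factor 2 from `2*sepCount≤`; a leftover edge gains none, hence the floor.
  -- Denominators are cleared to stay in `ℕ`.
  ∑-pairWeight-≤ : ∀ m → 2 ^ ⌊ m /2⌋ * ∑ (allLabellings m α 2) pairWeight ≤ length E ^ m
  ∑-pairWeight-≤ zero       = ≤-refl
  ∑-pairWeight-≤ (suc zero) = begin
    1 * ∑ (allLabellings 1 α 2) pairWeight      ≡⟨ *-identityˡ _ ⟩
    ∑ (allLabellings 1 α 2) pairWeight          ≡⟨ ∑-allVecs-suc E 0 pairWeight ⟩
    ∑ E (λ _ → 1)                               ≤⟨ ∑-≤ E (λ _ → ≤-refl) ⟩
    length E * 1                                ∎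
    where open ≤-Reasoning
  ∑-pairWeight-≤ (suc (suc m)) = begin
    2 * 2 ^ ⌊ m /2⌋ * ∑ (allLabellings (2 + m) α 2) pairWeight
      ≡⟨ cong (2 * 2 ^ ⌊ m /2⌋ *_) (∑-pairWeight-suc² m) ⟩
    2 * 2 ^ ⌊ m /2⌋ * (sepCount * W)
      ≡⟨ interchange 2 (2 ^ ⌊ m /2⌋) sepCount W ⟩
    2 * sepCount * (2 ^ ⌊ m /2⌋ * W)
      ≤⟨ *-mono-≤ 2*sepCount≤ (∑-pairWeight-≤ m) ⟩
    length E * length E * length E ^ m
      ≡⟨ *-assoc (length E) (length E) _ ⟩
    length E * (length E * length E ^ m) ∎
    where
    open ≤-Reasoning
    W = ∑ (allLabellings m α 2) pairWeight
    interchange : ∀ a b c d → a * b * (c * d) ≡ a * c * (b * d)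
    interchange = solve-∀

  explorable-count-≤ : ∀ m → 2 ^ ⌊ m /2⌋ * length (filter explorable? (allLabellings m α 2)) ≤
                             length (allLabellings m α 2)
  explorable-count-≤ m = begin
    2 ^ ⌊ m /2⌋ * length (filter explorable? (allLabellings m α 2))
      ≤⟨ *-monoʳ-≤ (2 ^ ⌊ m /2⌋) (length-filter-≤-∑ explorable? pairWeight
           (λ L ex → separated⇒1≤pairWeight L (explorable⇒separated L ex))
           (allLabellings m α 2)) ⟩
    2 ^ ⌊ m /2⌋ * ∑ (allLabellings m α 2) pairWeight
      ≤⟨ ∑-pairWeight-≤ m ⟩
    length E ^ m
      ≡⟨ length-allVecs E m ⟨
    length (allLabellings m α 2) ∎
    where open ≤-Reasoning

-- From counts to the limit.

n<2^n : ∀ n → n < 2 ^ n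
n<2^n zero    = s≤s z≤n
n<2^n (suc n) = begin-strict
  suc n             ≤⟨ n<2^n n ⟩
  2 ^ n             <⟨ m<m+n (2 ^ n) (m^n>0 2 n) ⟩
  2 ^ n + 2 ^ n     ≡⟨ cong (2 ^ n +_) (+-identityʳ (2 ^ n)) ⟨
  2 ^ suc n         ∎
  where open ≤-Reasoning

-- After cross-multiplication the goal is `k * d < p * n` for `ε = p / d`; positivity of `ε` gives
-- `p ≥ 1`, so `k * d < n` suffices.
/-<-positive : ∀ k n .{{_ : NonZero n}} (ε : ℚ) → 0ℚ ℚ.< ε → k * ℚ.↧ₙ ε < n → ℤ.+ k ℚ./ n ℚ.< ε
/-<-positive k n@(suc _) ε@(mkℚ (ℤ.+ suc p) d-1 _) _ kq<n =
  ℚₚ.toℚᵘ-cancel-< (ℚᵘₚ.<-respˡ-≃ (ℚᵘₚ.≃-sym (ℚₚ.toℚᵘ-fromℚᵘ (ℤ.+ k ℚᵘ./ n))) (ℚᵘ.*<* (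
    subst₂ ℤ._<_ (ℤₚ.pos-* k (suc d-1)) (ℤₚ.pos-* (suc p) n)
      (+<+ (<-≤-trans kq<n (m≤n*m n (suc p)))))))
/-<-positive _ _ (mkℚ (ℤ.+ zero) _ _)     (ℚ.*<* (+<+ ()))
/-<-positive _ _ (mkℚ (ℤ.-[1+ _ ]) _ _) (ℚ.*<* ())

∣/∣ : ∀ k n .{{_ : NonZero n}} → ℚ.∣ ℤ.+ k ℚ./ n ℚ.- 0ℚ ∣ ≡ ℤ.+ k ℚ./ n
∣/∣ k n = trans (cong ℚ.∣_∣ (ℚₚ.+-identityʳ (ℤ.+ k ℚ./ n)))
  (ℚₚ.0≤p⇒∣p∣≡p (ℚₚ.nonNegative⁻¹ _ {{ℚₚ.normalize-nonNeg k n}}))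

theorem8 : (α : ℕ → ℕ) (4≤α : ∀ n → 4 ≤ α n) →
    (λ n → explorationProbability n (α n) 2 {{4≤⇒nonZero (4≤α n)}}) TendsTo 0ℚ
-- The `suc` accounts for the centre: `n ≥ 1 + 2 * q` leaves `m ≥ 2 * q` edges, hence at least `q`
-- pairs.
theorem8 α 4≤α ε 0<ε = suc (q + q) , λ n n≥N →
  let
    m     = n ∸ 1
    Ω     = allLabellings m (α n) 2
    count = length (filter explorable? Ω)
    instance
      Ω≢0 : NonZero (length Ω)
      Ω≢0 = allLabellings-nonZero m (α n) 2 {{4≤⇒nonZero (4≤α n)}}
  in
  subst (ℚ._< ε) (sym (∣/∣ count (length Ω)))
    (/-<-positive count (length Ω) ε 0<ε
      (count*q<total count (length Ω) (q≤half (∸-monoˡ-≤ 1 n≥N)) (explorable-count-≤ {α n} m)))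
  where
  q = ℚ.↧ₙ ε

  q≤half : ∀ {m} → q + q ≤ m → q ≤ ⌊ m /2⌋
  q≤half 2q≤m = ≤-trans (≤-reflexive (n≡⌊n+n/2⌋ q)) (⌊n/2⌋-mono 2q≤m)

  -- The proportion `k / n` is at most `1 / 2 ^ h`, and `2 ^ h > h ≥ q` puts it below `1 / q`.
  count*q<total : ∀ k n {h} .{{_ : NonZero n}} → q ≤ h → 2 ^ h * k ≤ n → k * q < n
  -- With a zero count, strictness comes from `n` being nonzero, since multiplying by `k` would lose
  -- it.
  count*q<total zero    (suc n)     _   _      = s≤s z≤n
  count*q<total (suc k) n       {h} q≤h 2^hk≤n = begin-strict
    suc k * q     <⟨ *-monoʳ-< (suc k) (≤-<-trans q≤h (n<2^n h)) ⟩
    suc k * 2 ^ h ≡⟨ *-comm (suc k) (2 ^ h) ⟩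
    2 ^ h * suc k ≤⟨ 2^hk≤n ⟩
    n             ∎
    where open ≤-Reasoning
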